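{- For every level $t \in \mathcal{L}$ there exist finitely many levels $u_1, \ldots, u_n$, each generated by the grammar $u ::= s^k(x) \mid s^k(0) \mid \operatorname{imax}(u, x)$ (with $k \in \mathbb{N}$ and $x \in \mathcal{X}$), such that $t =_{\mathcal{L}} \max(u_1, \ldots, u_n)$.
   Context: $\operatorname{imax}\colon \mathbb{N}\times\mathbb{N}\to\mathbb{N}$ is defined by $\operatorname{imax}(i,0)=0$ and $\operatorname{imax}(i,j+1)=\max(i,j+1)$. Levels are the terms of the grammar $t ::= x \mid 0 \mid s(t) \mid \max(t,t) \mid \operatorname{imax}(t,t)$, where $x$ ranges over a countable set of variables $\mathcal{X}$; $\mathcal{L}$ denotes the set of levels; $s^k$ denotes $k$ applications of $s$. A valuation is a function $\sigma\colon\mathcal{X}\to\mathbb{N}$; the value $[t]_\sigma$ is defined by $[0]_\sigma=0$, $[x]_\sigma=\sigma(x)$, $[s(t)]_\sigma=[t]_\sigma+1$, $[\max(t_1,t_2)]_\sigma=\max([t_1]_\sigma,[t_2]_\sigma)$, $[\operatorname{imax}(t_1,t_2)]_\sigma=\operatorname{imax}([t_1]_\sigma,[t_2]_\sigma)$. $t_1 =_{\mathcal{L}} t_2$ means $[t_1]_\sigma=[t_2]_\sigma$ for every valuation $\sigma$. -}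

module Defs where

open import Data.List.NonEmpty using (List⁺; foldr₁)
open import Data.Nat using (ℕ; zero; suc; _⊔_)
open import Data.Nat.GeneralisedArithmetic using (fold)
open import Relation.Binary.PropositionalEquality using (_≡_)

imaxℕ : ℕ → ℕ → ℕ
imaxℕ i zero    = zero
imaxℕ i (suc j) = i ⊔ suc j

data Level (X : Set) : Set where
  var  : X → Level X
  𝟎    : Level X
  s    : Level X → Level X
  max  : Level X → Level X → Level X
  imax : Level X → Level X → Level X

s^ : {X : Set} → ℕ → Level X → Level X
s^ k t = fold t s k

Valuation : Set → Set
Valuation X = X → ℕ

⟦_⟧ : {X : Set} → Level X → Valuation X → ℕ
⟦ var x ⟧      σ = σ x
⟦ 𝟎 ⟧          σ = 0
⟦ s t ⟧        σ = suc (⟦ t ⟧ σ)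
⟦ max t₁ t₂ ⟧  σ = ⟦ t₁ ⟧ σ ⊔ ⟦ t₂ ⟧ σ
⟦ imax t₁ t₂ ⟧ σ = imaxℕ (⟦ t₁ ⟧ σ) (⟦ t₂ ⟧ σ)

infix 4 _=ℒ_

_=ℒ_ : {X : Set} → Level X → Level X → Set
_=ℒ_ {X} t₁ t₂ = (σ : Valuation X) → ⟦ t₁ ⟧ σ ≡ ⟦ t₂ ⟧ σ

data U {X : Set} : Level X → Set where
  s^-var : (k : ℕ) (x : X) → U (s^ k (var x))
  s^-𝟎   : (k : ℕ) → U (s^ k 𝟎)
  imax-x : {u : Level X} → U u → (x : X) → U (imax u (var x))

-- max(u₁, …, uₙ) for n ≥ 1 is the level max(u₁, max(u₂, … uₙ)); for n = 1 it is u₁.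
maxⁿ : {X : Set} → List⁺ (Level X) → Level X
maxⁿ = foldr₁ max

{-# OPTIONS --safe #-}
module Submission where

-- The levels equal to a maximum of grammar terms are closed under s, max and
-- imax.  Both s and imax (in either argument) distribute over max, which leaves
-- grammar terms as arguments; these are handled by
--   s(imax(u,x))      = max(s(x), imax(s(u),x)),
--   imax(a,imax(u,x)) = max(imax(a,x), imax(u,x)),
--   imax(a,s(u))      = max(a, s(u)).

open import Defs
open import Algebra.Bundles using (IdempotentCommutativeMonoid)
import Algebra.Properties.IdempotentCommutativeMonoid as ICM
open import Data.List.Base using ([]; _∷_)
open import Data.List.NonEmpty using (List⁺; _∷_; [_]; _⁺++⁺_)
open import Data.List.NonEmpty.Relation.Unary.All using (All; _∷_; toList⁺)
open import Data.List.Relation.Unary.All using ([])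
open import Data.List.Relation.Unary.All.Properties using (++⁺)
open import Data.Nat using (ℕ; zero; suc; _⊔_)
open import Data.Nat.Properties using (⊔-assoc; ⊔-comm; ⊔-idem; ⊔-identityʳ; ⊔-0-isCommutativeMonoid; m≤n⇒m⊔n≡n; n≤1+n)
open import Data.Product using (Σ-syntax; _×_; _,_)
open import Function.Bundles using (_↣_)
open import Level using (0ℓ)
open import Relation.Binary.PropositionalEquality using (_≡_; refl; sym; trans; cong; cong₂; module ≡-Reasoning)

-- Idempotence makes `⊔` distribute over itself; for positive second arguments, distributivity of
-- `imaxℕ` is exactly this.
⊔-0-idempotentCommutativeMonoid : IdempotentCommutativeMonoid 0ℓ 0ℓ
⊔-0-idempotentCommutativeMonoid = record
  { isIdempotentCommutativeMonoid = record
    { isCommutativeMonoid = ⊔-0-isCommutativeMonoid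
    ; idem                = ⊔-idem
    }
  }

open ICM ⊔-0-idempotentCommutativeMonoid using ()
  renaming (∙-distrˡ-∙ to ⊔-distribˡ-⊔; ∙-distrʳ-∙ to ⊔-distribʳ-⊔)

imaxℕ-distribʳ-⊔ : ∀ k i j → imaxℕ (i ⊔ j) k ≡ imaxℕ i k ⊔ imaxℕ j k
imaxℕ-distribʳ-⊔ zero    i j = refl
imaxℕ-distribʳ-⊔ (suc k) i j = ⊔-distribʳ-⊔ (suc k) i j

imaxℕ-distribˡ-⊔ : ∀ i j k → imaxℕ i (j ⊔ k) ≡ imaxℕ i j ⊔ imaxℕ i k
imaxℕ-distribˡ-⊔ i zero    k       = refl
imaxℕ-distribˡ-⊔ i (suc j) zero    = sym (⊔-identityʳ (i ⊔ suc j))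
imaxℕ-distribˡ-⊔ i (suc j) (suc k) = ⊔-distribˡ-⊔ i (suc j) (suc k)

-- For positive `k` the inner value is positive too, so every `imaxℕ` is `⊔`. Splitting on `j`
-- exposes the successor in `j ⊔ suc k` that lets the outer `imaxℕ` reduce.
imaxℕ-imaxℕ : ∀ i j k → imaxℕ i (imaxℕ j k) ≡ imaxℕ i k ⊔ imaxℕ j k
imaxℕ-imaxℕ i j       zero    = refl
imaxℕ-imaxℕ i zero    (suc k) = trans (sym (⊔-assoc i zero (suc k))) (⊔-distribʳ-⊔ (suc k) i zero)
imaxℕ-imaxℕ i (suc j) (suc k) = trans (sym (⊔-assoc i (suc j) (suc k))) (⊔-distribʳ-⊔ (suc k) i (suc j))

-- The second argument must remain a variable, so only `i` is incremented. The term `suc j` makes up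
-- for this: it gives 1 when `j` is 0 and supplies the missing increment otherwise.
suc-imaxℕ : ∀ i j → suc (imaxℕ i j) ≡ suc j ⊔ imaxℕ (suc i) j
suc-imaxℕ i zero    = refl
suc-imaxℕ i (suc j) = cong suc (begin
  i ⊔ suc j         ≡⟨ cong (i ⊔_) (m≤n⇒m⊔n≡n (n≤1+n j)) ⟨
  i ⊔ (j ⊔ suc j)   ≡⟨ ⊔-assoc i j (suc j) ⟨
  (i ⊔ j) ⊔ suc j   ≡⟨ ⊔-comm (i ⊔ j) (suc j) ⟩
  suc j ⊔ (i ⊔ j)   ∎)
  where open ≡-Reasoning

-- Closing under =ℒ and binary max, instead of speaking of lists, lets every
-- closure property be proved by rewriting with one semantic identity.
data Normal {X : Set} : Level X → Set where
  atom : ∀ {u} → U u → Normal u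
  join : ∀ {t₁ t₂} → Normal t₁ → Normal t₂ → Normal (max t₁ t₂)
  resp : ∀ {t₁ t₂} → t₁ =ℒ t₂ → Normal t₂ → Normal t₁

module _ {X : Set} where

  private
    variable
      t t₁ t₂ u : Level X

  Normal-imax-var : Normal t → (x : X) → Normal (imax t (var x))
  Normal-imax-var (atom u) x = atom (imax-x u x)
  Normal-imax-var (join {t₁} {t₂} n₁ n₂) x =
    resp (λ σ → imaxℕ-distribʳ-⊔ (σ x) (⟦ t₁ ⟧ σ) (⟦ t₂ ⟧ σ))
         (join (Normal-imax-var n₁ x) (Normal-imax-var n₂ x))
  Normal-imax-var (resp eq n) x =
    resp (λ σ → cong (λ i → imaxℕ i (σ x)) (eq σ)) (Normal-imax-var n x)

  Normal-s-U : U u → Normal (s u)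
  Normal-s-U (s^-var k x) = atom (s^-var (suc k) x)
  Normal-s-U (s^-𝟎 k)     = atom (s^-𝟎 (suc k))
  Normal-s-U (imax-x {u} p x) =
    resp (λ σ → suc-imaxℕ (⟦ u ⟧ σ) (σ x))
         -- The recursive result may be a maximum and not a single grammar term, so `imax-x` alone
         -- would not suffice.
         (join (atom (s^-var 1 x)) (Normal-imax-var (Normal-s-U p) x))

  Normal-s : Normal t → Normal (s t)
  Normal-s (atom u)     = Normal-s-U u
  Normal-s (join n₁ n₂) = resp (λ σ → refl) (join (Normal-s n₁) (Normal-s n₂))
  Normal-s (resp eq n)  = resp (λ σ → cong suc (eq σ)) (Normal-s n)

  Normal-imax-U : Normal t → U u → Normal (imax t u)
  Normal-imax-U n (s^-var zero x)    = Normal-imax-var n x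
  -- A successor is positive under every valuation, so here `imax` computes to `max`.
  Normal-imax-U n (s^-var (suc k) x) = resp (λ σ → refl) (join n (atom (s^-var (suc k) x)))
  Normal-imax-U n (s^-𝟎 zero)        = resp (λ σ → refl) (atom (s^-𝟎 zero))
  Normal-imax-U n (s^-𝟎 (suc k))     = resp (λ σ → refl) (join n (atom (s^-𝟎 (suc k))))
  Normal-imax-U {t} n (imax-x {u} p x) =
    resp (λ σ → imaxℕ-imaxℕ (⟦ t ⟧ σ) (⟦ u ⟧ σ) (σ x))
         -- The second summand is the given grammar term itself, so no recursion on `p` is needed.
         (join (Normal-imax-var n x) (atom (imax-x p x)))

  Normal-imax : Normal t₁ → Normal t₂ → Normal (imax t₁ t₂)
  Normal-imax n (atom u) = Normal-imax-U n u
  Normal-imax {t} n (join {t₁} {t₂} n₁ n₂) =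
    resp (λ σ → imaxℕ-distribˡ-⊔ (⟦ t ⟧ σ) (⟦ t₁ ⟧ σ) (⟦ t₂ ⟧ σ))
         (join (Normal-imax n n₁) (Normal-imax n n₂))
  Normal-imax {t} n (resp eq n′) =
    resp (λ σ → cong (imaxℕ (⟦ t ⟧ σ)) (eq σ)) (Normal-imax n n′)

  normal : (t : Level X) → Normal t
  normal (var x)      = atom (s^-var zero x)
  normal 𝟎            = atom (s^-𝟎 zero)
  normal (s t)        = Normal-s (normal t)
  normal (max t₁ t₂)  = join (normal t₁) (normal t₂)
  normal (imax t₁ t₂) = Normal-imax (normal t₁) (normal t₂)

  -- `maxⁿ` nests to the right, so each further element of the first list costs one reassociation.
  maxⁿ-⁺++⁺ : ∀ u us vs → max (maxⁿ (u ∷ us)) (maxⁿ vs) =ℒ maxⁿ {X} ((u ∷ us) ⁺++⁺ vs)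
  maxⁿ-⁺++⁺ u []        vs σ = refl
  maxⁿ-⁺++⁺ u (u′ ∷ us) vs σ =
    trans (⊔-assoc (⟦ u ⟧ σ) (⟦ maxⁿ (u′ ∷ us) ⟧ σ) (⟦ maxⁿ vs ⟧ σ))
          (cong (⟦ u ⟧ σ ⊔_) (maxⁿ-⁺++⁺ u′ us vs σ))

  All-⁺++⁺ : ∀ {P : Level X → Set} {us vs} → All P us → All P vs → All P (us ⁺++⁺ vs)
  All-⁺++⁺ (p ∷ ps) (q ∷ qs) = p ∷ ++⁺ ps (toList⁺ (q ∷ qs))

  flatten : Normal t → Σ[ us ∈ List⁺ (Level X) ] (All U us × t =ℒ maxⁿ us)
  flatten (atom {u} p) = [ u ] , p ∷ [] , λ σ → refl
  flatten (join n₁ n₂) with flatten n₁ | flatten n₂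
  ... | (u ∷ us) , ps , eq₁ | vs , qs , eq₂ =
    (u ∷ us) ⁺++⁺ vs , All-⁺++⁺ ps qs ,
    λ σ → trans (cong₂ _⊔_ (eq₁ σ) (eq₂ σ)) (maxⁿ-⁺++⁺ u us vs σ)
  flatten (resp eq n) with flatten n
  -- `resp` leaves the list unchanged and only extends the chain of equalities.
  ... | us , ps , eq′ = us , ps , λ σ → trans (eq σ) (eq′ σ)

theorem18 : (X : Set) → X ↣ ℕ → (t : Level X) → Σ[ us ∈ List⁺ (Level X) ] (All U us × t =ℒ maxⁿ us)
theorem18 X _ t = flatten (normal t)
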